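{- For every $n\ge 1$, the number $a_n$ of topologically distinct endstates of Planted Brussels Sprouts whose initial state has $n$ arms is \[a_n=\frac{1}{2n-1}\binom{3n-3}{n-1}.\]
   Context: Planted Brussels Sprouts of order $n$: start with a closed disk with $n$ marked points on its boundary circle, labeled $1,\dots,n$ in clockwise order. Attached to each marked point is an arm, a short segment pointing into the interior of the disk; these arms are free. A move consists of two steps. First, choose two free arms and join their free ends by a simple curve (an arc) in the disk that does not intersect any previously drawn arc or arm; the two joined arms cease to be free. Second, mark a point (a notch) on the arc, from which two new free arms emanate, one on each side of the arc. The game ends when no move is possible, and the final configuration is called an endstate. Long labels: the original arm at point $i$ has long label $i$. If an arc joins arms with long labels $\alpha$ and $\beta$, the two new arms receive long labels $(\alpha,\beta)$ and $(\beta,\alpha)$, placed so that, going clockwise around the notch, one sees the old arm $\alpha$, the new arm $(\alpha,\beta)$, the old arm $\beta$, and the new arm $(\beta,\alpha)$. Two endstates are topologically equivalent (counted once) iff some homeomorphism of the disk carries one to the other preserving long labels; equivalently, iff they have the same set of long labels. -}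

module Defs where

open import Data.Fin.Base using (Fin)
open import Data.List.Base using (List; _∷_; _++_; [_]; map; allFin)
open import Data.List.Relation.Binary.BagAndSetEquality using (set; [_]-Equality)
open import Data.Nat.Base using (ℕ)
open import Data.Product.Base using (Σ-syntax; _×_; proj₁)
open import Function.Bundles using (Inverse)
open import Level using (0ℓ)
open import Relation.Binary.Bundles using (Setoid)
open import Relation.Binary.Construct.Closure.ReflexiveTransitive using (Star)
import Relation.Binary.Construct.On as On
open import Relation.Binary.PropositionalEquality.Properties using (setoid)
open import Relation.Nullary.Negation.Core using (¬_)

private
  variable
    n : ℕ

-- The point numbered i on the boundary circle is i - 1 : Fin n.
data Label (n : ℕ) : Set where
  arm   : Fin n → Label n
  ⟨_,_⟩ : Label n → Label n → Label n

-- A region of the disk cut out by the arcs drawn so far.  The boundary circle,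
-- the arms and the arcs always form a connected set, so each region inside
-- the disk is simply connected and has a single boundary walk.  A region is
-- recorded by the free arms pointing into it, in clockwise order as seen from
-- inside it: a cyclic word, written as a list by cutting it at an arbitrary
-- place.
Region : ℕ → Set
Region n = List (Label n)

-- The order in which regions and labels are listed carries no meaning.
record State (n : ℕ) : Set where
  constructor state
  field
    labels  : List (Label n)   -- of all arms drawn so far, free or not
    regions : List (Region n)

open State public

initial : ∀ n → State n
initial n = state (map arm (allFin n)) [ map arm (allFin n) ]

-- An arc can join two free arms exactly when they point into the same region,
-- which it then splits in two.  Let α, u, β, w be the clockwise cyclic word of
-- that region.  Going clockwise around the notch one sees α, the new arm
-- pointing towards u, β, and the new arm pointing towards w; the former is
-- therefore ⟨ α , β ⟩ and the latter ⟨ β , α ⟩, and the new regions are the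
-- cyclic words u, ⟨ α , β ⟩ and w, ⟨ β , α ⟩.  Below, u is ys and the cyclic
-- word is cut inside w, so that w is zs followed by xs.  Naming the two arms in
-- the order in which they occur in the list loses no move, since exchanging
-- (α , u) with (β , w) gives the same result.
infix 4 _⟶_

data _⟶_ {n : ℕ} : State n → State n → Set where
  join : ∀ {ls} rs₁ rs₂ xs α ys β zs →
         state ls (rs₁ ++ (xs ++ α ∷ ys ++ β ∷ zs) ∷ rs₂)
         ⟶
         state (⟨ α , β ⟩ ∷ ⟨ β , α ⟩ ∷ ls)
               (rs₁ ++ (ys ++ [ ⟨ α , β ⟩ ]) ∷ (xs ++ ⟨ β , α ⟩ ∷ zs) ∷ rs₂)

_⟶*_ : State n → State n → Set
_⟶*_ = Star _⟶_

IsEndstate : State n → Set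
IsEndstate {n} s = (initial n ⟶* s) × (∀ t → ¬ (s ⟶ t))

Endstate : ℕ → Set
Endstate n = Σ[ s ∈ State n ] IsEndstate s

-- Topological equivalence: having the same set of long labels.
Endstates : ℕ → Setoid 0ℓ 0ℓ
Endstates n = On.setoid {B = Endstate n} ([ set ]-Equality (Label n)) (λ e → labels (proj₁ e))

HasCardinality : Setoid 0ℓ 0ℓ → ℕ → Set
HasCardinality S a = Inverse S (setoid (Fin a))

{-# OPTIONS --safe #-}
module Submission where

-- Cut a region at an arbitrary place into a word.  When the play inside it is over, the free
-- arm o left at the cut is either the only letter of the word, or o = ⟨ δ , γ ⟩ where γ and δ
-- are the arms left over from playing on a prefix g and on a suffix d of the word; the rest p
-- of the word then forms, together with ⟨ γ , δ ⟩, a region of its own.  By recursion, outcomes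
-- of the play on a word of length m + 1 are encoded by the ternary trees with m nodes, whose
-- number is given by a ballot formula.
--
-- A tree can be recovered from the set S of labels.  An arm α is used by at most one arc, so
-- α ↦ ⟨ β , α ⟩ ∈ S is a partial function; iterating it from the first letter of the word
-- leads to o, hence to γ and δ, and the arms occurring in γ and δ determine g and d.

open import Data.Empty using (⊥; ⊥-elim)
open import Data.Fin.Base using (Fin; zero)
open import Data.Fin.Properties using (+↔⊎)
open import Data.List.Base using (List; []; _∷_; [_]; _++_; map; concat; length; allFin)
open import Data.List.Membership.Propositional using (_∈_; _∉_; find)
open import Data.List.Membership.Propositional.Properties using (∈-map⁻; ∈-++⁺ˡ; ∈-++⁺ʳ; ∈-concat⁺′)
open import Data.List.Properties
  using (∷-injective; ∷-injectiveʳ; length-++; length-map; length-tabulate; ++-assoc;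
         ++-identityʳ; ++-cancelˡ; ++-conicalʳ; ++-monoid; concat-++)
open import Data.List.Relation.Binary.BagAndSetEquality
  using (set; _∼[_]_; [_]-Equality; bag-=⇒; ↭⇒∼bag)
open import Data.List.Relation.Binary.Permutation.Propositional
  using (_↭_; prep; ↭-refl; ↭-reflexive; ↭-sym; ↭-trans; ↭⇒↭ₛ)
open import Data.List.Relation.Binary.Permutation.Propositional.Properties
  using (++-commutativeMonoid; ∈-resp-↭; ++⁺ˡ; ++⁺ʳ; shifts)
open import Data.List.Relation.Binary.Subset.Propositional using (_⊆_)
open import Data.List.Relation.Unary.All as All using (All; []; _∷_)
import Data.List.Relation.Unary.All.Properties as All using (++⁻; ++⁻ʳ; ++⁺)
open import Data.List.Relation.Unary.AllPairs using ([]; _∷_)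
open import Data.List.Relation.Unary.Any using (Any; here; there)
import Data.List.Relation.Unary.Any.Properties as Any using (++⁺ˡ; ++⁺ʳ; ++⁻)
open import Data.List.Relation.Unary.Unique.Propositional using (Unique)
import Data.List.Relation.Unary.Unique.Propositional.Properties as Unique using (map⁺; allFin⁺)
open import Data.Nat.Base using (ℕ; zero; suc; _+_; _*_; _∸_; _≤_)
open import Data.Nat.Combinatorics using (_C_; nCk+nC[k+1]≡[n+1]C[k+1]; nC1≡n)
open import Data.Nat.Properties
  using (≡-irrelevant; suc-injective; +-identityʳ; +-assoc; +-comm; +-cancelˡ-≡; +-cancelʳ-≡;
         *-comm; *-assoc; *-suc; *-zeroʳ; *-distribˡ-+; *-cancelˡ-≡)
open import Data.Nat.Tactic.RingSolver using (solve-∀)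
open import Data.Product.Base using (Σ-syntax; ∃-syntax; ∃₂; _×_; _,_; proj₁; proj₂; map₂)
open import Data.Sum.Base using (_⊎_; inj₁; inj₂)
open import Data.Sum.Function.Propositional using (_⊎-↔_)
open import Data.Vec.Base using (Vec; []; _∷_)
open import Function.Base using (_∘_)
open import Function.Bundles using (Inverse; Equivalence; _↔_; mk↔ₛ′)
open import Function.Construct.Composition using (_↔-∘_; inverse)
open import Function.Construct.Symmetry using (↔-sym)
open import Relation.Binary.Bundles using (Setoid)
open import Relation.Binary.Construct.Closure.ReflexiveTransitive using (Star; ε; _◅_; _◅◅_)
open import Relation.Binary.Construct.Closure.ReflexiveTransitive.Properties
  using (module StarReasoning)
open import Relation.Binary.PropositionalEquality
  using (_≡_; _≢_; refl; sym; trans; cong; cong₂; subst; setoid; module ≡-Reasoning)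
open import Relation.Nullary.Negation.Core using (¬_)
open import Defs

-- Ternary trees, counted through forests

data Tree : Set where
  leaf : Tree
  node : Tree → Tree → Tree → Tree

private
  variable
    n : ℕ
    A : Set
    α β γ δ ε′ o o′ : Label n
    w w′ g p d : Region n
    ls ls′ ls₁ ls₂ ls₃ : List (Label n)
    fs fs′ fs₁ fs₂ fs₃ rs : List (Region n)
    t t′ t₁ t₂ t₃ : Tree

size : Tree → ℕ
size leaf         = 0
size (node a b c) = suc (size a + size b + size c)

total : ∀ {r} → Vec Tree r → ℕ
total []       = 0
total (t ∷ ts) = size t + total ts

-- Forests make a recursion possible: deleting the root of the first tree leaves its three subtrees
-- as trees of the forest.
Forest : ℕ → ℕ → Set
Forest m r = Σ[ ts ∈ Vec Tree r ] total ts ≡ m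

Forest-≡ : ∀ {m r} {F G : Forest m r} → proj₁ F ≡ proj₁ G → F ≡ G
Forest-≡ {F = _ , p} {G = _ , q} refl = cong (_ ,_) (≡-irrelevant p q)

total-node : ∀ {r} a b c (ts : Vec Tree r) →
             total (node a b c ∷ ts) ≡ suc (total (a ∷ b ∷ c ∷ ts))
total-node a b c ts = regroup (size a) (size b) (size c) (total ts)
  where
  regroup : ∀ x y z w → suc (x + y + z) + w ≡ suc (x + (y + (z + w)))
  regroup = solve-∀

-- The Raney numbers r / (3 m + r) C(3 m + r, m), for m + r > 0. The first tree is either a leaf,
-- which is dropped, or a node, which is replaced by its subtrees.
#forests : ℕ → ℕ → ℕ
#forests zero    zero    = 1
#forests (suc m) zero    = 0
#forests zero    (suc r) = #forests zero r
#forests (suc m) (suc r) = #forests (suc m) r + #forests m (3 + r)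

Forest-zero-suc : ∀ {r} → Forest zero (suc r) ↔ Forest zero r
Forest-zero-suc = mk↔ₛ′ to (λ (ts , eq) → leaf ∷ ts , eq) (λ _ → refl) from∘to
  where
  to : Forest zero (suc _) → Forest zero _
  to (leaf ∷ ts , eq) = ts , eq

  from∘to : ∀ F → _ ≡ F
  from∘to (leaf ∷ ts , eq) = refl

Forest-suc-suc : ∀ {m r} → Forest (suc m) (suc r) ↔ (Forest (suc m) r ⊎ Forest m (3 + r))
Forest-suc-suc {m} {r} = mk↔ₛ′ to from to∘from from∘to
  where
  to : Forest (suc m) (suc r) → Forest (suc m) r ⊎ Forest m (3 + r)
  to (leaf       ∷ ts , eq) = inj₁ (ts , eq)
  to (node a b c ∷ ts , eq) =
    inj₂ (a ∷ b ∷ c ∷ ts , suc-injective (trans (sym (total-node a b c ts)) eq))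

  from : Forest (suc m) r ⊎ Forest m (3 + r) → Forest (suc m) (suc r)
  from (inj₁ (ts , eq))             = leaf ∷ ts , eq
  from (inj₂ (a ∷ b ∷ c ∷ ts , eq)) =
    node a b c ∷ ts , trans (total-node a b c ts) (cong suc eq)

  to∘from : ∀ x → to (from x) ≡ x
  to∘from (inj₁ _)                    = refl
  to∘from (inj₂ (a ∷ b ∷ c ∷ ts , _)) = cong inj₂ (Forest-≡ refl)

  from∘to : ∀ F → from (to F) ≡ F
  from∘to (leaf       ∷ ts , _) = refl
  from∘to (node a b c ∷ ts , _) = Forest-≡ refl

Forest↔Fin : ∀ m r → Forest m r ↔ Fin (#forests m r)
Forest↔Fin zero    zero    =
  mk↔ₛ′ (λ _ → zero) (λ _ → [] , refl) (λ { zero → refl }) (λ { ([] , refl) → refl })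
Forest↔Fin (suc m) zero    = mk↔ₛ′ (λ { ([] , ()) }) (λ ()) (λ ()) (λ { ([] , ()) })
Forest↔Fin zero    (suc r) = Forest↔Fin zero r ↔-∘ Forest-zero-suc
Forest↔Fin (suc m) (suc r) =
  ↔-sym +↔⊎ ↔-∘ ((Forest↔Fin (suc m) r ⊎-↔ Forest↔Fin m (3 + r)) ↔-∘ Forest-suc-suc)

Tree↔Fin : ∀ m → (Σ[ t ∈ Tree ] size t ≡ m) ↔ Fin (#forests m 1)
Tree↔Fin m = Forest↔Fin m 1 ↔-∘ mk↔ₛ′
  (λ (t , eq) → t ∷ [] , trans (+-identityʳ (size t)) eq)
  (λ { (t ∷ [] , eq) → t , trans (sym (+-identityʳ (size t))) eq })
  (λ { (t ∷ [] , eq) → Forest-≡ refl })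
  (λ (t , eq) → cong (t ,_) (≡-irrelevant _ eq))

-- Closed form for the number of ternary trees

module _ where
  open ≡-Reasoning

  absorption : ∀ n k → suc k * (suc n C suc k) ≡ suc n * (n C k)
  absorption zero    zero    = refl
  absorption zero    (suc k) = *-zeroʳ k
  absorption (suc n) zero    = begin
    1 * ((2 + n) C 1)  ≡⟨ cong (1 *_) (nC1≡n (2 + n)) ⟩
    1 * (2 + n)        ≡⟨ *-comm 1 (2 + n) ⟩
    (2 + n) * 1        ∎
  absorption (suc n) (suc k) = begin
    (2 + k) * ((2 + n) C (2 + k))
      ≡⟨ cong ((2 + k) *_) (nCk+nC[k+1]≡[n+1]C[k+1] (suc n) (suc k)) ⟨
    (2 + k) * (x + (suc n C (2 + k)))
      ≡⟨ *-distribˡ-+ (2 + k) x _ ⟩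
    (x + suc k * x) + (2 + k) * (suc n C (2 + k))
      ≡⟨ cong₂ (λ y z → (x + y) + z) (absorption n k) (absorption n (suc k)) ⟩
    (x + suc n * (n C k)) + suc n * (n C suc k)
      ≡⟨ +-assoc x _ _ ⟩
    x + (suc n * (n C k) + suc n * (n C suc k))
      ≡⟨ cong (x +_) (*-distribˡ-+ (suc n) (n C k) (n C suc k)) ⟨
    x + suc n * ((n C k) + (n C suc k))
      ≡⟨ cong (λ y → x + suc n * y) (nCk+nC[k+1]≡[n+1]C[k+1] n k) ⟩
    (2 + n) * x
      ∎
    where
    x : ℕ
    x = suc n C suc k

  #forests-zero : ∀ r → #forests 0 r ≡ 1
  #forests-zero zero    = refl
  #forests-zero (suc r) = #forests-zero r

  -- With m = k + 1 and N = 3 m + r this is the ballot formula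
  -- (r / N) C(N, m) = C(N, m) - 3 C(N - 1, m - 1).
  #forests-suc : ∀ k r → #forests (suc k) r + 3 * ((2 + r + 3 * k) C k) ≡ (3 + r + 3 * k) C suc k
  -- An empty forest has no node, so what remains is 3 C(3 k + 2, k) = C(3 k + 3, k + 1), which is
  -- absorption after cancelling k + 1.
  #forests-suc k zero = *-cancelˡ-≡ _ _ (suc k) (begin
    suc k * (3 * b)                ≡⟨ *-assoc (suc k) 3 b ⟨
    suc k * 3 * b                  ≡⟨ cong (_* b) (*-comm (suc k) 3) ⟩
    3 * suc k * b                  ≡⟨ cong (_* b) (*-suc 3 k) ⟩
    (3 + 3 * k) * b                ≡⟨ absorption (2 + 3 * k) k ⟨
    suc k * ((3 + 3 * k) C suc k)  ∎)
    where
    b : ℕ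
    b = (2 + 3 * k) C k
  #forests-suc k (suc r) = begin
    (x + y) + 3 * (suc N C k)        ≡⟨ +-assoc x y _ ⟩
    x + (y + 3 * (suc N C k))        ≡⟨ cong (x +_) (step k) ⟩
    x + (3 * (N C k) + (suc N C k))  ≡⟨ +-assoc x _ _ ⟨
    (x + 3 * (N C k)) + (suc N C k)  ≡⟨ cong (_+ (suc N C k)) (#forests-suc k r) ⟩
    (suc N C suc k) + (suc N C k)    ≡⟨ +-comm (suc N C suc k) _ ⟩
    (suc N C k) + (suc N C suc k)    ≡⟨ nCk+nC[k+1]≡[n+1]C[k+1] (suc N) k ⟩
    suc (suc N) C suc k              ∎
    where
    x y N : ℕ
    x = #forests (suc k) r
    y = #forests k (3 + r)
    N = 2 + r + 3 * k

    -- This is the ballot formula itself for `k` nodes and `3 + r` trees, rewritten by Pascal's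
    -- rule; `k = 0` lies outside that formula.
    step : ∀ k → #forests k (3 + r) + 3 * ((3 + r + 3 * k) C k) ≡
                 3 * ((2 + r + 3 * k) C k) + ((3 + r + 3 * k) C k)
    step zero    = cong (_+ 3) (#forests-zero r)
    step (suc j) = begin
      z + 3 * (suc M C suc j)
        ≡⟨ cong (λ b → z + 3 * b) (nCk+nC[k+1]≡[n+1]C[k+1] M j) ⟨
      z + 3 * ((M C j) + (M C suc j))
        ≡⟨ regroup z (M C j) (M C suc j) ⟩
      3 * (M C suc j) + (z + 3 * (M C j))
        ≡⟨ cong (3 * (M C suc j) +_) ih ⟩
      3 * (M C suc j) + (suc M C suc j)
        ∎
      where
      z M : ℕ
      z = #forests (suc j) (3 + r)
      M = 2 + r + 3 * suc j

      M≡ : 2 + (3 + r) + 3 * j ≡ M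
      M≡ = expand r j
        where
        expand : ∀ r j → 2 + (3 + r) + 3 * j ≡ 2 + r + 3 * suc j
        expand = solve-∀

      ih : z + 3 * (M C j) ≡ suc M C suc j
      ih = subst (λ M → z + 3 * (M C j) ≡ suc M C suc j) M≡ (#forests-suc j (3 + r))

      regroup : ∀ z a b → z + 3 * (a + b) ≡ 3 * b + (z + 3 * a)
      regroup = solve-∀

  -- For m = k + 1, put x = C(3 m, m) and y = C(3 m, m - 1). The ballot formula for r = 1 gives f +
  -- 2 y = x, and absorption gives m x = (2 m + 1) y. Adding 2 m x to both sides avoids subtraction.
  #forests-one : ∀ m → (1 + 2 * m) * #forests m 1 ≡ (3 * m) C m
  #forests-one zero    = refl
  #forests-one (suc k) = +-cancelʳ-≡ (2 * (suc k * x)) _ _ (begin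
    (1 + 2 * suc k) * f + 2 * (suc k * x)
      ≡⟨ cong (λ y → (1 + 2 * suc k) * f + 2 * y) absorb ⟩
    (1 + 2 * suc k) * f + 2 * ((1 + 2 * suc k) * y)
      ≡⟨ factor (1 + 2 * suc k) f y ⟩
    (1 + 2 * suc k) * (f + 2 * y)
      ≡⟨ cong ((1 + 2 * suc k) *_) f+2y≡x ⟩
    (1 + 2 * suc k) * x
      ≡⟨ distrib (suc k) x ⟩
    x + 2 * (suc k * x)
      ∎)
    where
    f x y N : ℕ
    N = 3 * suc k
    f = #forests (suc k) 1
    x = N C suc k
    y = N C k

    factor : ∀ a f y → a * f + 2 * (a * y) ≡ a * (f + 2 * y)
    factor = solve-∀

    distrib : ∀ a x → (1 + 2 * a) * x ≡ x + 2 * (a * x)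
    distrib = solve-∀

    pascal : y + x ≡ suc N C suc k
    pascal = nCk+nC[k+1]≡[n+1]C[k+1] N k

    f+2y≡x : f + 2 * y ≡ x
    f+2y≡x = +-cancelʳ-≡ y _ _ (begin
      f + 2 * y + y              ≡⟨ regroup f y ⟩
      f + 3 * y                  ≡⟨ cong (λ N → f + 3 * (N C k)) (*-suc 3 k) ⟩
      f + 3 * ((3 + 3 * k) C k)  ≡⟨ #forests-suc k 1 ⟩
      (4 + 3 * k) C suc k        ≡⟨ cong (λ N → suc N C suc k) (*-suc 3 k) ⟨
      suc N C suc k              ≡⟨ pascal ⟨
      y + x                      ≡⟨ +-comm y x ⟩
      x + y                      ∎)
      where
      regroup : ∀ f y → f + 2 * y + y ≡ f + 3 * y
      regroup = solve-∀

    absorb : suc k * x ≡ (1 + 2 * suc k) * y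
    absorb = +-cancelˡ-≡ (suc k * y) _ _ (begin
      suc k * y + suc k * x            ≡⟨ *-distribˡ-+ (suc k) y x ⟨
      suc k * (y + x)                  ≡⟨ cong (suc k *_) pascal ⟩
      suc k * (suc N C suc k)          ≡⟨ absorption N k ⟩
      suc N * y                        ≡⟨ regroup (suc k) y ⟩
      suc k * y + (1 + 2 * suc k) * y  ∎)
      where
      regroup : ∀ a y → suc (3 * a) * y ≡ a * y + (1 + 2 * a) * y
      regroup = solve-∀

-- Foldings: outcomes of the play on a word

-- Folding t w o ls fs: playing on the word w as prescribed by t leaves the free arm o at the
-- cut, creates the arms ls and finishes the regions fs away from the cut.
data Folding {n : ℕ} :
       Tree → Region n → Label n → List (Label n) → List (Region n) → Set where
  leaf : Folding leaf [ α ] α [] []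
  node : Folding t₁ g γ ls₁ fs₁ →
         Folding t₂ d δ ls₂ fs₂ →
         Folding t₃ (p ++ [ ⟨ γ , δ ⟩ ]) ε′ ls₃ fs₃ →
         Folding (node t₁ t₂ t₃) (g ++ p ++ d) ⟨ δ , γ ⟩
                 (ls₃ ++ ⟨ γ , δ ⟩ ∷ ⟨ δ , γ ⟩ ∷ ls₂ ++ ls₁)
                 (fs₁ ++ fs₂ ++ fs₃ ++ [ [ ε′ ] ])

++-compare : ∀ (us : List A) {vs} us′ {vs′} → us ++ vs ≡ us′ ++ vs′ →
             (∃[ c ] us′ ≡ us ++ c × vs ≡ c ++ vs′) ⊎
             (∃[ c ] us ≡ us′ ++ c × vs′ ≡ c ++ vs)
++-compare []       us′        eq = inj₁ (us′ , refl , eq)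
++-compare (x ∷ us) []         eq = inj₂ (x ∷ us , refl , sym eq)
++-compare (x ∷ us) (y ∷ us′)  eq with ∷-injective eq
... | refl , eq′ with ++-compare us us′ eq′
...   | inj₁ (c , refl , eq″) = inj₁ (c , refl , eq″)
...   | inj₂ (c , refl , eq″) = inj₂ (c , refl , eq″)

locate : ∀ (us : List A) {vs} xs {x zs} → us ++ vs ≡ xs ++ x ∷ zs →
         (∃[ ws ] us ≡ xs ++ x ∷ ws × zs ≡ ws ++ vs) ⊎
         (∃[ ws ] xs ≡ us ++ ws × vs ≡ ws ++ x ∷ zs)
locate us xs eq with ++-compare us xs eq
... | inj₁ (c , eq₁ , eq₂)       = inj₂ (c , eq₁ , eq₂)
-- Here `us` ends just before `x`, so `x` is the first letter of `vs`.
... | inj₂ ([] , refl , eq₂)     =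
  inj₂ ([] , sym (trans (++-identityʳ _) (++-identityʳ _)) , sym eq₂)
... | inj₂ (y ∷ c , refl , refl) = inj₁ (c , refl , refl)

++-split : ∀ m {k} (xs : List A) → length xs ≡ m + k →
           ∃₂ λ us vs → xs ≡ us ++ vs × length us ≡ m × length vs ≡ k
++-split zero    xs       eq = [] , xs , refl , refl , eq
++-split (suc m) (x ∷ xs) eq with us , vs , refl , p , q ← ++-split m xs (suc-injective eq) =
  x ∷ us , vs , refl , cong suc p , q

length-∷ʳ : ∀ (xs : List A) x → length (xs ++ [ x ]) ≡ suc (length xs)
length-∷ʳ xs x = trans (length-++ xs) (+-comm (length xs) 1)

-- The words `g` and `d` have one letter more than their trees have nodes. The word `p` has as many
-- as its tree, since `⟨ γ , δ ⟩` is appended to it.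
span-sizes : ∀ a b c → suc (suc (a + b + c)) ≡ suc a + (c + suc b)
span-sizes = solve-∀

folding-size : Folding {n} t w o ls fs → length w ≡ suc (size t)
folding-size leaf = refl
folding-size (node {t₁} {g} {t₂ = t₂} {d} {t₃ = t₃} {p} G D P) = begin
  length (g ++ p ++ d)
    ≡⟨ length-++ g ⟩
  length g + length (p ++ d)
    ≡⟨ cong (length g +_) (length-++ p) ⟩
  length g + (length p + length d)
    ≡⟨ cong₂ _+_ (folding-size G) (cong₂ _+_ |p| (folding-size D)) ⟩
  suc (size t₁) + (size t₃ + suc (size t₂))
    ≡⟨ span-sizes (size t₁) (size t₂) (size t₃) ⟨
  suc (suc (size t₁ + size t₂ + size t₃))
    ∎
  where
  open ≡-Reasoning

  |p| : length p ≡ size t₃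
  |p| = suc-injective (trans (sym (length-∷ʳ p _)) (folding-size P))

folding-exists : ∀ t (w : Region n) → length w ≡ suc (size t) →
                 ∃[ o ] ∃₂ λ ls fs → Folding t w o ls fs
folding-exists leaf (α ∷ []) refl = α , [] , [] , leaf
folding-exists (node t₁ t₂ t₃) w eq
  with g , r , refl , |g| , |r| ← ++-split (suc (size t₁)) {size t₃ + suc (size t₂)} w
                                    (trans eq (span-sizes (size t₁) (size t₂) (size t₃)))
  with p , d , refl , |p| , |d| ← ++-split (size t₃) r |r|
  with γ , _ , _ , G ← folding-exists t₁ g |g|
  with δ , _ , _ , D ← folding-exists t₂ d |d|
  with _ , _ , _ , P ← folding-exists t₃ (p ++ [ ⟨ γ , δ ⟩ ])
                         (trans (length-∷ʳ p _) (cong suc |p|))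
  = _ , _ , _ , node G D P

inner-size : Folding {n} t (w ++ [ α ]) o ls fs → length w ≡ size t
inner-size {w = w} F = suc-injective (trans (sym (length-∷ʳ w _)) (folding-size F))

++-injective : ∀ (us us′ : List A) {vs vs′} → length us ≡ length us′ →
               us ++ vs ≡ us′ ++ vs′ → us ≡ us′ × vs ≡ vs′
++-injective []       []         _   eq = refl , eq
++-injective (x ∷ us) (y ∷ us′)  len eq with refl , eq′ ← ∷-injective eq
  with refl , refl ← ++-injective us us′ (suc-injective len) eq′ = refl , refl

-- The sizes of the subtrees fix the lengths of `g`, `p` and `d`, so the tree alone decides where
-- the word is cut.
folding-deterministic : Folding {n} t w o ls fs → Folding t w′ o′ ls′ fs′ →
                        w ≡ w′ → o ≡ o′ × ls ≡ ls′
folding-deterministic leaf leaf refl = refl , refl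
folding-deterministic (node {g = g} {p = p} G D P) (node {g = g′} {p = p′} G′ D′ P′) eq
  with refl , eq′ ← ++-injective g g′ (trans (folding-size G) (sym (folding-size G′))) eq
  with refl , refl ← ++-injective p p′ (trans (inner-size P) (sym (inner-size P′))) eq′
  with refl , refl ← folding-deterministic G G′ refl
  with refl , refl ← folding-deterministic D D′ refl
  with refl , refl ← folding-deterministic P P′ refl
  = refl , refl

-- Every folding is realized by a play

module _ {n : ℕ} where
  open StarReasoning (_⟶_ {n})

  -- Play on `g`, then on `d`, join the leftover arms, and finally play in the region cut off. The
  -- context `xs`, `zs` is needed because `g` and `d` are only parts of a region.
  folding⇒play : ∀ {ls₀} → Folding t w o ls fs → ∀ rs₁ xs zs rs₂ →
                 state {n} ls₀ (rs₁ ++ (xs ++ w ++ zs) ∷ rs₂) ⟶*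
                 state (ls ++ ls₀) (rs₁ ++ fs ++ (xs ++ o ∷ zs) ∷ rs₂)
  folding⇒play leaf rs₁ xs zs rs₂ = ε
  folding⇒play {ls₀ = ls₀}
    (node {g = g} {γ} {ls₁} {fs₁} {d = d} {δ} {ls₂} {fs₂} {p = p} {ε′} {ls₃} {fs₃} G D P)
    rs₁ xs zs rs₂ = begin
    state ls₀ (rs₁ ++ (xs ++ (g ++ p ++ d) ++ zs) ∷ rs₂)
      ≡⟨ cong (λ r → state ls₀ (rs₁ ++ (xs ++ r) ∷ rs₂))
           (trans (++-assoc g (p ++ d) zs) (cong (g ++_) (++-assoc p d zs))) ⟩
    state ls₀ (rs₁ ++ (xs ++ g ++ p ++ d ++ zs) ∷ rs₂)
      ⟶*⟨ folding⇒play G rs₁ xs _ rs₂ ⟩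
    state (ls₁ ++ ls₀) (rs₁ ++ fs₁ ++ (xs ++ γ ∷ p ++ d ++ zs) ∷ rs₂)
      ≡⟨ cong (state _) (shift-region rs₁ fs₁ (sym (++-assoc xs (γ ∷ p) _))) ⟩
    state (ls₁ ++ ls₀) (rs₁₂ ++ ((xs ++ γ ∷ p) ++ d ++ zs) ∷ rs₂)
      ⟶*⟨ folding⇒play D rs₁₂ (xs ++ γ ∷ p) zs rs₂ ⟩
    state (ls₂ ++ ls₁ ++ ls₀) (rs₁₂ ++ fs₂ ++ ((xs ++ γ ∷ p) ++ δ ∷ zs) ∷ rs₂)
      ≡⟨ cong (state _) (shift-region rs₁₂ fs₂ (++-assoc xs (γ ∷ p) _)) ⟩
    state (ls₂ ++ ls₁ ++ ls₀) (rs₁₂₃ ++ (xs ++ γ ∷ p ++ δ ∷ zs) ∷ rs₂)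
      ⟶⟨ join rs₁₂₃ rs₂ xs γ p δ zs ⟩
    state (⟨ γ , δ ⟩ ∷ ⟨ δ , γ ⟩ ∷ ls₂ ++ ls₁ ++ ls₀) (rs₁₂₃ ++ (p ++ [ ⟨ γ , δ ⟩ ]) ∷ rest)
      ≡⟨ cong (λ r → state _ (rs₁₂₃ ++ r ∷ rest)) (++-identityʳ (p ++ [ ⟨ γ , δ ⟩ ])) ⟨
    state (⟨ γ , δ ⟩ ∷ ⟨ δ , γ ⟩ ∷ ls₂ ++ ls₁ ++ ls₀)
          (rs₁₂₃ ++ ((p ++ [ ⟨ γ , δ ⟩ ]) ++ []) ∷ rest)
      ⟶*⟨ folding⇒play P rs₁₂₃ [] [] rest ⟩
    state (ls₃ ++ ⟨ γ , δ ⟩ ∷ ⟨ δ , γ ⟩ ∷ ls₂ ++ ls₁ ++ ls₀) (rs₁₂₃ ++ fs₃ ++ [ ε′ ] ∷ rest)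
      ≡⟨ cong₂ state labels-≡ regions-≡ ⟩
    state ((ls₃ ++ ⟨ γ , δ ⟩ ∷ ⟨ δ , γ ⟩ ∷ ls₂ ++ ls₁) ++ ls₀)
          (rs₁ ++ (fs₁ ++ fs₂ ++ fs₃ ++ [ [ ε′ ] ]) ++ rest)
      ∎
    where
    rs₁₂ rs₁₂₃ rest : List (Region n)
    rs₁₂  = rs₁ ++ fs₁
    rs₁₂₃ = rs₁₂ ++ fs₂
    rest  = (xs ++ ⟨ δ , γ ⟩ ∷ zs) ∷ rs₂

    shift-region : ∀ rs fs {r r′} → r ≡ r′ → rs ++ fs ++ r ∷ rs₂ ≡ (rs ++ fs) ++ r′ ∷ rs₂
    shift-region rs fs refl = sym (++-assoc rs fs _)

    labels-≡ : ls₃ ++ ⟨ γ , δ ⟩ ∷ ⟨ δ , γ ⟩ ∷ ls₂ ++ ls₁ ++ ls₀ ≡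
               (ls₃ ++ ⟨ γ , δ ⟩ ∷ ⟨ δ , γ ⟩ ∷ ls₂ ++ ls₁) ++ ls₀
    labels-≡ = solve 4 (λ a b c e → a ⊕ (b ⊕ (c ⊕ e)) ⊜ (a ⊕ (b ⊕ c)) ⊕ e) refl
                 ls₃ (⟨ γ , δ ⟩ ∷ ⟨ δ , γ ⟩ ∷ ls₂) ls₁ ls₀
      where open import Algebra.Solver.Monoid (++-monoid (Label n))

    regions-≡ : rs₁₂₃ ++ fs₃ ++ [ ε′ ] ∷ rest ≡
                rs₁ ++ (fs₁ ++ fs₂ ++ fs₃ ++ [ [ ε′ ] ]) ++ rest
    regions-≡ = solve 6
      (λ a b c e f h → ((a ⊕ b) ⊕ c) ⊕ (e ⊕ (f ⊕ h)) ⊜ a ⊕ ((b ⊕ (c ⊕ (e ⊕ f))) ⊕ h)) refl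
      rs₁ fs₁ fs₂ fs₃ [ [ ε′ ] ] rest
      where open import Algebra.Solver.Monoid (++-monoid (Region n))

-- Invariants of the set of labels

-- ⟨ β , α ⟩ ∈ ls says that α has been used up by an arc to β.  Since ⟨ α , β ⟩ is drawn along
-- with ⟨ β , α ⟩, it suffices to consider second components.
record Consistent {n : ℕ} (ls free : List (Label n)) : Set where
  field
    unique     : Unique free
    drawn      : free ⊆ ls
    closed     : ∀ {α β} → ⟨ β , α ⟩ ∈ ls → α ∈ ls
    unmatched  : ∀ {α β} → α ∈ free → ⟨ β , α ⟩ ∉ ls
    functional : ∀ {α β γ} → ⟨ β , α ⟩ ∈ ls → ⟨ γ , α ⟩ ∈ ls → β ≡ γ

open Consistent

consistent-resp-↭ : ∀ {F F′} → F ↭ F′ → Consistent {n} ls F → Consistent ls F′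
consistent-resp-↭ F↭F′ c = record
  { unique     = Unique-resp-↭ (↭⇒↭ₛ F↭F′) (unique c)
  ; drawn      = drawn c ∘ ∈-resp-↭ (↭-sym F↭F′)
  ; closed     = closed c
  ; unmatched  = unmatched c ∘ ∈-resp-↭ (↭-sym F↭F′)
  ; functional = functional c
  }
  where
  open import Data.List.Relation.Binary.Permutation.Setoid.Properties (setoid _)
    using (Unique-resp-↭)

-- The new labels are fresh: if `⟨ α , β ⟩` were already drawn, `β` would not be free. By `closed`,
-- no earlier arc can then have used a new arm.
consistent-join : ∀ {F} → Consistent {n} ls (α ∷ β ∷ F) →
                  Consistent (⟨ α , β ⟩ ∷ ⟨ β , α ⟩ ∷ ls) (⟨ α , β ⟩ ∷ ⟨ β , α ⟩ ∷ F)
consistent-join {ls = ls} {α} {β} {F} c with unique c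
... | (α≢β ∷ α∉F) ∷ (β∉F ∷ uniqueF) = record
  { unique     = ((λ { refl → α≢β refl })
                  ∷ All.tabulate (λ { γ∈F refl → αβ∉ls (drawn c (there (there γ∈F))) }))
                 ∷ All.tabulate (λ { γ∈F refl → βα∉ls (drawn c (there (there γ∈F))) })
                 ∷ uniqueF
  ; drawn      = λ { (here eq) → here eq ; (there (here eq)) → there (here eq)
                   ; (there (there γ∈F)) → there (there (drawn c (there (there γ∈F)))) }
  ; closed     = λ { (here refl) → there (there (drawn c (there (here refl))))
                   ; (there (here refl)) → there (there (drawn c (here refl)))
                   ; (there (there m)) → there (there (closed c m)) }
  ; unmatched  = λ { (here refl) (there (there m)) → αβ∉ls (closed c m)
                   ; (here refl) (here ())
                   ; (here refl) (there (here ()))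
                   ; (there (here refl)) (there (there m)) → βα∉ls (closed c m)
                   ; (there (here refl)) (here ())
                   ; (there (here refl)) (there (here ()))
                   ; (there (there γ∈F)) (here refl) → All.lookup β∉F γ∈F refl
                   ; (there (there γ∈F)) (there (here refl)) → All.lookup α∉F γ∈F refl
                   ; (there (there γ∈F)) (there (there m)) → unmatched c (there (there γ∈F)) m }
  ; functional = λ { (here refl) (here refl) → refl
                   ; (here refl) (there (here refl)) → refl
                   ; (there (here refl)) (here refl) → refl
                   ; (there (here refl)) (there (here refl)) → refl
                   ; (here refl) (there (there m)) → ⊥-elim (unmatched c (there (here refl)) m)
                   ; (there (here refl)) (there (there m)) → ⊥-elim (unmatched c (here refl) m)
                   ; (there (there m)) (here refl) → ⊥-elim (unmatched c (there (here refl)) m)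
                   ; (there (there m)) (there (here refl)) → ⊥-elim (unmatched c (here refl) m)
                   ; (there (there m)) (there (there m′)) → functional c m m′ }
  }
  where
  αβ∉ls : ⟨ α , β ⟩ ∉ ls
  αβ∉ls = unmatched c (there (here refl))

  βα∉ls : ⟨ β , α ⟩ ∉ ls
  βα∉ls = unmatched c (here refl)

ConsistentState : State n → Set
ConsistentState s = Consistent (labels s) (concat (regions s))

module _ {n : ℕ} where
  open import Algebra.Solver.CommutativeMonoid (++-commutativeMonoid {A = Label n})

  concat-split : ∀ (rs₁ rs₂ : List (Region n)) {r} →
                 concat (rs₁ ++ r ∷ rs₂) ↭ concat rs₁ ++ r ++ concat rs₂
  concat-split rs₁ rs₂ = ↭-reflexive (sym (concat-++ rs₁ _))

  consistent-⟶ : ∀ {s t : State n} → s ⟶ t → ConsistentState s → ConsistentState t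
  consistent-⟶ (join rs₁ rs₂ xs α ys β zs) =
    consistent-resp-↭ after ∘ consistent-join ∘ consistent-resp-↭ before
    where
    rest : List (Label n)
    rest = concat rs₁ ++ xs ++ ys ++ zs ++ concat rs₂

    before : concat (rs₁ ++ (xs ++ α ∷ ys ++ β ∷ zs) ∷ rs₂) ↭ α ∷ β ∷ rest
    before = ↭-trans (concat-split rs₁ rs₂)
      (solve 7 (λ a b x c y e f → a ⊕ ((b ⊕ (x ⊕ (c ⊕ (y ⊕ e)))) ⊕ f) ⊜
                                  x ⊕ (y ⊕ (a ⊕ (b ⊕ (c ⊕ (e ⊕ f))))))
        ↭-refl (concat rs₁) xs [ α ] ys [ β ] zs (concat rs₂))

    after : ⟨ α , β ⟩ ∷ ⟨ β , α ⟩ ∷ rest ↭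
            concat (rs₁ ++ (ys ++ [ ⟨ α , β ⟩ ]) ∷ (xs ++ ⟨ β , α ⟩ ∷ zs) ∷ rs₂)
    after = ↭-sym (↭-trans (concat-split rs₁ _)
      (solve 7 (λ a b x c y e f → a ⊕ ((c ⊕ x) ⊕ ((b ⊕ (y ⊕ e)) ⊕ f)) ⊜
                                  x ⊕ (y ⊕ (a ⊕ (b ⊕ (c ⊕ (e ⊕ f))))))
        ↭-refl (concat rs₁) xs [ ⟨ α , β ⟩ ] ys [ ⟨ β , α ⟩ ] zs (concat rs₂)))

  consistent-⟶* : ∀ {s t : State n} → s ⟶* t → ConsistentState s → ConsistentState t
  consistent-⟶* ε        = λ c → c
  consistent-⟶* (m ◅ ms) = consistent-⟶* ms ∘ consistent-⟶ m

arms : ∀ n → Region n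
arms n = map arm (allFin n)

arms-unique : ∀ n → Unique (arms n)
arms-unique n = Unique.map⁺ (λ { refl → refl }) (Unique.allFin⁺ n)

pair∉arms : ⟨ α , β ⟩ ∉ arms n
pair∉arms m with ∈-map⁻ arm m
... | _ , _ , ()

consistent-initial : ∀ n → ConsistentState (initial n)
consistent-initial n = subst (Consistent (arms n)) (sym (++-identityʳ (arms n))) record
  { unique     = arms-unique n
  ; drawn      = λ m → m
  ; closed     = λ m → ⊥-elim (pair∉arms m)
  ; unmatched  = λ _ → pair∉arms
  ; functional = λ m → ⊥-elim (pair∉arms m)
  }

-- Original arms occurring in labels and words

data Occurs {n : ℕ} (i : Fin n) : Label n → Set where
  here  : Occurs i (arm i)
  left  : Occurs i α → Occurs i ⟨ α , β ⟩
  right : Occurs i β → Occurs i ⟨ α , β ⟩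

some-occurs : ∀ (α : Label n) → ∃[ i ] Occurs i α
some-occurs (arm i)   = i , here
some-occurs ⟨ α , β ⟩ = map₂ left (some-occurs α)

Meets : Fin n → Region n → Set
Meets i = Any (Occurs i)

-- Equivalently, letters at different positions share no original arm. The form by cuts suits the
-- factorizations of words below.
Separated : Region n → Set
Separated w = ∀ u v → w ≡ u ++ v → ∀ {i} → Meets i u → Meets i v → ⊥

separated-factor : ∀ (u v x : Region n) → Separated (u ++ v ++ x) → Separated v
separated-factor u v x sep v₁ v₂ refl m₁ m₂ =
  sep (u ++ v₁) (v₂ ++ x) (trans (cong (u ++_) (++-assoc v₁ v₂ x)) (sym (++-assoc u v₁ _)))
    (Any.++⁺ʳ u m₁) (Any.++⁺ˡ m₂)

separated-∷ʳ : ∀ (v : Region n) {α} → Separated v → (∀ {i} → Meets i v → ¬ Occurs i α) →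
               Separated (v ++ [ α ])
separated-∷ʳ v sep new u₁ u₂ eq m₁ m₂ with locate u₁ v (sym eq)
... | inj₁ (ws , refl , eq′) with refl ← ++-conicalʳ ws u₂ (sym eq′) with () ← m₂
... | inj₂ (ws , refl , refl) with Any.++⁻ ws m₂
...   | inj₁ m         = sep u₁ ws refl m₁ m
...   | inj₂ (here oc) = new (Any.++⁺ˡ m₁) oc

separated-arms : ∀ n → Separated (arms n)
separated-arms n u v eq {i} m₁ m₂ =
  disjoint u (subst Unique eq (arms-unique n))
    (in-arms u (λ m → subst (_ ∈_) (sym eq) (∈-++⁺ˡ m)) m₁)
    (in-arms v (λ m → subst (_ ∈_) (sym eq) (∈-++⁺ʳ u m)) m₂)
  where
  in-arms : ∀ u → u ⊆ arms n → Meets i u → arm i ∈ u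
  in-arms u u⊆ m with find m
  ... | α , α∈u , oc with ∈-map⁻ arm (u⊆ α∈u)
  ...   | j , _ , refl with here ← oc = α∈u

  disjoint : ∀ {α} u {v} → Unique (u ++ v) → α ∈ u → α ∉ v
  disjoint (x ∷ u) (x∉ ∷ _)  (here refl) α∈v = All.lookup x∉ (∈-++⁺ʳ u α∈v) refl
  disjoint (x ∷ u) (_ ∷ uni) (there α∈u) α∈v = disjoint u uni α∈u α∈v

output⊆word : ∀ {i} → Folding {n} t w o ls fs → Occurs i o → Meets i w
output⊆word leaf                         oc         = here oc
output⊆word (node {g = g} {p = p} G D P) (left oc)  =
  Any.++⁺ʳ g (Any.++⁺ʳ p (output⊆word D oc))
output⊆word (node G D P)                 (right oc) = Any.++⁺ˡ (output⊆word G oc)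

module _ (g p d : Region n) (sep : Separated (g ++ p ++ d)) where

  separated-last : Separated d
  separated-last = separated-factor (g ++ p) d []
    (subst Separated (solve 3 (λ a b c → a ⊕ (b ⊕ c) ⊜ (a ⊕ b) ⊕ (c ⊕ id)) refl g p d) sep)
    where open import Algebra.Solver.Monoid (++-monoid (Label n))

  -- The original arms in `⟨ γ , δ ⟩` come from `g` and `d`, which share none with `p`.
  separated-inner : Folding t₁ g γ ls₁ fs₁ → Folding t₂ d δ ls₂ fs₂ →
                    Separated (p ++ [ ⟨ γ , δ ⟩ ])
  separated-inner G D = separated-∷ʳ p (separated-factor g p d sep) λ where
    m (left oc)  → sep g (p ++ d) refl (output⊆word G oc) (Any.++⁺ˡ m)
    m (right oc) → sep (g ++ p) d (sym (++-assoc g p d)) (Any.++⁺ʳ g m) (output⊆word D oc)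

-- Recovering the tree from the labels

-- Of the two new arms on the arc that uses `α`, a step always takes the one with `α` as second
-- component. This is the arm that stays at the cut when `α` is left over from `g`.
data Next {n : ℕ} (S : List (Label n)) : Label n → Label n → Set where
  next : ⟨ β , α ⟩ ∈ S → Next S α ⟨ β , α ⟩

occurs-next* : ∀ {S i} → Star (Next {n} S) α β → Occurs i α → Occurs i β
occurs-next* ε             oc = oc
occurs-next* (next _ ◅ ms) oc = occurs-next* ms (right oc)

-- The first letter of `g` leads to `γ`, and the last arc adds the step from `γ` to `⟨ δ , γ ⟩`.
-- Since `S` may be any larger set, two foldings can be compared inside one `S`.
first : Folding {n} t w o ls fs →
        ∃₂ λ α v → w ≡ α ∷ v × (∀ {S} → ls ⊆ S → Star (Next S) α o)
first leaf = _ , _ , refl , λ _ → ε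
first (node {ls₁ = ls₁} {ls₂ = ls₂} {ls₃ = ls₃} G D P) with first G
... | α , v , refl , chain = α , _ , refl , λ ls⊆S →
  chain (λ m → ls⊆S (∈-++⁺ʳ ls₃ (there (there (∈-++⁺ʳ ls₂ m))))) ◅◅
  (next (ls⊆S (∈-++⁺ʳ ls₃ (there (here refl)))) ◅ ε)

last-occurs : Folding {n} t w o ls fs →
              ∃₂ λ v α → w ≡ v ++ [ α ] × (∀ {i} → Occurs i α → Occurs i o)
last-occurs leaf = [] , _ , refl , λ oc → oc
last-occurs (node {g = g} {p = p} G D P) with last-occurs D
... | v , α , refl , occ = g ++ p ++ v , α ,
  solve 4 (λ a b c e → a ⊕ (b ⊕ (c ⊕ e)) ⊜ (a ⊕ (b ⊕ c)) ⊕ e) refl g p v [ α ] ,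
  left ∘ occ
  where open import Algebra.Solver.Monoid (++-monoid (Label _))

-- The last letter of a nonempty `c` would occur in `γ`, hence share an original arm with `g`.
prefix-unique : ∀ (g c v : Region n) → Folding t g γ ls fs → Folding t′ (g ++ c) γ ls′ fs′ →
                Separated (g ++ c ++ v) → c ≡ []
prefix-unique g []      v F F′ sep = refl
prefix-unique g (x ∷ c) v F F′ sep with last-occurs F′
... | u , α , eq , occ with some-occurs α | locate g u eq
...   | i , oc | inj₁ (ws , _ , eq′) with () ← ++-conicalʳ ws (x ∷ c) (sym eq′)
...   | i , oc | inj₂ (ws , _ , eq′) =
  ⊥-elim (sep g (x ∷ c ++ v) refl (output⊆word F (occ oc))
    (Any.++⁺ˡ (subst (Meets i) (sym eq′) (Any.++⁺ʳ ws (here oc)))))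

-- The chain from the first letter of a nonempty `c` ends in `δ`, so that letter would share an
-- original arm with `d`.
suffix-unique : ∀ (u c d : Region n) → Folding t d δ ls fs → Folding t′ (c ++ d) δ ls′ fs′ →
                Separated (u ++ c ++ d) → c ≡ []
suffix-unique u []      d F F′ sep = refl
suffix-unique u (x ∷ c) d F F′ sep with first F′
... | _ , _ , refl , chain with some-occurs x
...   | i , oc = ⊥-elim (sep (u ++ x ∷ c) d (sym (++-assoc u (x ∷ c) d)) (Any.++⁺ʳ u (here oc))
                   (output⊆word F (occurs-next* (chain (λ m → m)) oc)))

spans-unique : ∀ (g p d g′ p′ d′ : Region n) →
               Folding t₁ g γ ls₁ fs₁ → Folding t g′ γ ls fs →
               Folding t₂ d δ ls₂ fs₂ → Folding t′ d′ δ ls′ fs′ →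
               g ++ p ++ d ≡ g′ ++ p′ ++ d′ → Separated (g ++ p ++ d) →
               g ≡ g′ × p ≡ p′ × d ≡ d′
spans-unique {n} g p d g′ p′ d′ G G′ D D′ eq sep with g≡g′
  where
  g≡g′ : g ≡ g′
  g≡g′ with ++-compare g g′ eq
  ... | inj₁ (c , refl , eq₂)
    with refl ← prefix-unique g c (p′ ++ d′) G G′ (subst (λ r → Separated (g ++ r)) eq₂ sep)
    = sym (++-identityʳ g)
  ... | inj₂ (c , refl , eq₂)
    with refl ← prefix-unique g′ c (p ++ d) G′ G (subst Separated (++-assoc g′ c (p ++ d)) sep)
    = ++-identityʳ g′
... | refl with ++-compare p p′ (++-cancelˡ g _ _ eq)
... | inj₁ (c , refl , refl)
  with refl ← suffix-unique (g ++ p) c d′ D′ D (subst Separated (sym (++-assoc g p _)) sep)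
  = refl , sym (++-identityʳ p) , refl
... | inj₂ (c , refl , refl)
  with refl ← suffix-unique (g ++ p′) c d D D′
                (subst Separated
                  (trans (cong (g ++_) (++-assoc p′ c d)) (sym (++-assoc g p′ _))) sep)
  = refl , ++-identityʳ p′ , refl

module _ {n : ℕ} (S : List (Label n))
         (S-functional : ∀ {α β γ} → ⟨ β , α ⟩ ∈ S → ⟨ γ , α ⟩ ∈ S → β ≡ γ) where

  Unmatched : Label n → Set
  Unmatched α = ∀ {β} → ⟨ β , α ⟩ ∉ S

  chain-end-unique : Star (Next S) α β → Star (Next S) α γ → Unmatched β → Unmatched γ → β ≡ γ
  chain-end-unique ε             ε             _ _ = refl
  chain-end-unique ε             (next m ◅ _)  u _ = ⊥-elim (u m)
  chain-end-unique (next m ◅ _)  ε             _ u = ⊥-elim (u m)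
  chain-end-unique (next m ◅ ms) (next m′ ◅ ms′) u u′ with S-functional m m′
  ... | refl = chain-end-unique ms ms′ u u′

  record Compatible (ls : List (Label n)) (fs : List (Region n)) : Set where
    constructor compatible
    field
      labels⊆ : All (_∈ S) ls
      ends    : All (All Unmatched) fs

  open Compatible

  compatible-node : ∀ fs₁ fs₂ fs₃ →
    Compatible (ls₃ ++ α ∷ β ∷ ls₂ ++ ls₁) (fs₁ ++ fs₂ ++ fs₃ ++ [ [ ε′ ] ]) →
    Compatible ls₁ fs₁ × Compatible ls₂ fs₂ × Compatible ls₃ fs₃ × Unmatched ε′
  compatible-node {ls₃ = ls₃} {ls₂ = ls₂} fs₁ fs₂ fs₃ (compatible sub end)
    with sub₃ , _ ∷ _ ∷ sub₂₁ ← All.++⁻ ls₃ sub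
    with sub₂ , sub₁ ← All.++⁻ ls₂ sub₂₁
    with end₁ , end′ ← All.++⁻ fs₁ end
    with end₂ , end″ ← All.++⁻ fs₂ end′
    with end₃ , (u ∷ []) ∷ [] ← All.++⁻ fs₃ end″
    = compatible sub₁ end₁ , compatible sub₂ end₂ , compatible sub₃ end₃ , u

  output-unique : Folding t w o ls fs → Folding t′ w o′ ls′ fs′ →
                  Compatible ls fs → Compatible ls′ fs′ → Unmatched o → Unmatched o′ → o ≡ o′
  output-unique F F′ c c′ u u′ with first F | first F′
  ... | α , v , refl , chain | .α , .v , refl , chain′ =
    chain-end-unique (chain (All.lookup (labels⊆ c))) (chain′ (All.lookup (labels⊆ c′))) u u′

  -- Equality of outputs is a hypothesis because `γ` and `δ` are used by an arc, so that
  -- `output-unique` does not apply to them; they are read off from `o` instead.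
  folding-unique : Folding t w o ls fs → Folding t′ w′ o′ ls′ fs′ →
                   w ≡ w′ → o ≡ o′ → Separated w →
                   Compatible ls fs → Compatible ls′ fs′ → t ≡ t′
  folding-unique leaf leaf _ _ _ _ _ = refl
  folding-unique leaf F@(node _ _ _) eq _ _ _ _
    with () ← trans (cong length eq) (folding-size F)
  folding-unique F@(node _ _ _) leaf eq _ _ _ _
    with () ← trans (cong length (sym eq)) (folding-size F)
  folding-unique (node {g = g} {fs₁ = fs₁} {d = d} {fs₂ = fs₂} {p = p} {fs₃ = fs₃} G D P)
                 (node {fs₁ = fs₁′} {fs₂ = fs₂′} {fs₃ = fs₃′} G′ D′ P′) eq refl sep c c′
    with refl , refl , refl ← spans-unique _ _ _ _ _ _ G G′ D D′ eq sep
    with c₁ , c₂ , c₃ , u ← compatible-node fs₁ fs₂ fs₃ c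
    with c₁′ , c₂′ , c₃′ , u′ ← compatible-node fs₁′ fs₂′ fs₃′ c′
    -- The arm `ε′` is not visible in `o`, but it is unmatched and so is the end of its chain.
    with refl ← output-unique P P′ c₃ c₃′ u u′
    with refl ← folding-unique G G′ refl refl (separated-factor [] _ _ sep) c₁ c₁′
    with refl ← folding-unique D D′ refl refl (separated-last g p d sep) c₂ c₂′
    with refl ← folding-unique P P′ refl refl (separated-inner g p d sep G D) c₃ c₃′
    = refl

-- Every finished play comes from a folding

module _ {n : ℕ} {α β : Label n} {ys : Region n} where
  open import Algebra.Solver.CommutativeMonoid (++-commutativeMonoid {A = Label n})
    using (solve; _⊜_; _⊕_; id)

  unjoin-++ : ∀ xs zs v → xs ++ α ∷ ys ++ β ∷ zs ++ v ≡ (xs ++ α ∷ ys ++ β ∷ zs) ++ v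
  unjoin-++ xs zs v =
    M.solve 4 (λ a b c e → a M.⊕ (b M.⊕ (c M.⊕ e)) M.⊜ (a M.⊕ (b M.⊕ c)) M.⊕ e) refl
      xs (α ∷ ys) (β ∷ zs) v
    where import Algebra.Solver.Monoid (++-monoid (Label n)) as M

  -- Prepending a move to a play: where t₂ has the leaf ⟨ β , α ⟩, put node leaf leaf t₁.
  folding-unjoin : Folding t₁ (ys ++ [ ⟨ α , β ⟩ ]) γ ls₁ fs₁ → Folding t₂ w o ls₂ fs₂ →
                   ∀ xs {zs} → w ≡ xs ++ ⟨ β , α ⟩ ∷ zs →
                   ∃[ t ] ∃₂ λ ls fs → Folding t (xs ++ α ∷ ys ++ β ∷ zs) o ls fs ×
                                       ls ↭ ⟨ α , β ⟩ ∷ ⟨ β , α ⟩ ∷ ls₁ ++ ls₂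
  folding-unjoin {ls₁ = ls₁} F leaf [] refl = _ , _ , _ , node leaf leaf F ,
    solve 2 (λ a b → a ⊕ b ⊜ b ⊕ (a ⊕ id)) ↭-refl ls₁ (⟨ α , β ⟩ ∷ ⟨ β , α ⟩ ∷ [])
  folding-unjoin F leaf (x ∷ xs) eq with () ← ++-conicalʳ xs _ (sym (∷-injectiveʳ eq))
  folding-unjoin {ls₁ = ls} F
    (node {g = g} {γ} {ls₁ = ls₁} {d = d} {δ} {ls₂ = ls₂} {p = p} {ls₃ = ls₃} G D P) xs eq
    -- The letter `⟨ β , α ⟩` lies in `g`, `p` or `d`, and only the folding of that part changes.
    with locate g xs eq
  ... | inj₁ (ws , refl , refl) with _ , ls′ , _ , G′ , ls′↭ ← folding-unjoin F G xs refl =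
    _ , _ , _ , subst (λ w → Folding _ w _ _ _) (sym (unjoin-++ xs ws (p ++ d))) (node G′ D P) ,
    ↭-trans (++⁺ˡ ls₃ (++⁺ˡ (⟨ γ , δ ⟩ ∷ ⟨ δ , γ ⟩ ∷ ls₂) ls′↭))
      (solve 5 (λ n l a b c → a ⊕ (b ⊕ (n ⊕ (l ⊕ c))) ⊜ n ⊕ (l ⊕ (a ⊕ (b ⊕ c)))) ↭-refl
        (⟨ α , β ⟩ ∷ ⟨ β , α ⟩ ∷ []) ls ls₃ (⟨ γ , δ ⟩ ∷ ⟨ δ , γ ⟩ ∷ ls₂) ls₁)
  ... | inj₂ (ws , refl , eq′) with locate p ws eq′
  ...   | inj₁ (vs , refl , refl)
    with _ , ls′ , _ , P′ , ls′↭ ← folding-unjoin F P ws (++-assoc ws _ _) =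
    _ , _ , _ , subst (λ w → Folding _ w _ _ _)
      (trans (cong (g ++_) (sym (unjoin-++ ws vs d))) (sym (++-assoc g ws _)))
      (node G D (subst (λ w → Folding _ w _ _ _) (unjoin-++ ws vs _) P′)) ,
    ↭-trans (++⁺ʳ (⟨ γ , δ ⟩ ∷ ⟨ δ , γ ⟩ ∷ ls₂ ++ ls₁) ls′↭)
      (solve 4 (λ n l a b → (n ⊕ (l ⊕ a)) ⊕ b ⊜ n ⊕ (l ⊕ (a ⊕ b))) ↭-refl
        (⟨ α , β ⟩ ∷ ⟨ β , α ⟩ ∷ []) ls ls₃ (⟨ γ , δ ⟩ ∷ ⟨ δ , γ ⟩ ∷ ls₂ ++ ls₁))
  ...   | inj₂ (vs , refl , refl)
    with _ , ls′ , _ , D′ , ls′↭ ← folding-unjoin F D vs refl =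
    _ , _ , _ , subst (λ w → Folding _ w _ _ _)
      (trans (cong (g ++_) (sym (++-assoc p vs _))) (sym (++-assoc g (p ++ vs) _))) (node G D′ P) ,
    ↭-trans (++⁺ˡ ls₃ (++⁺ˡ (⟨ γ , δ ⟩ ∷ ⟨ δ , γ ⟩ ∷ []) (++⁺ʳ ls₁ ls′↭)))
      (solve 6 (λ n l a b c e → a ⊕ (b ⊕ ((n ⊕ (l ⊕ c)) ⊕ e)) ⊜ n ⊕ (l ⊕ (a ⊕ (b ⊕ (c ⊕ e))))) ↭-refl
        (⟨ α , β ⟩ ∷ ⟨ β , α ⟩ ∷ []) ls ls₃ (⟨ γ , δ ⟩ ∷ ⟨ δ , γ ⟩ ∷ []) ls₂ ls₁)

data Foldings {n : ℕ} : List (Region n) → List (Label n) → Set where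
  []  : Foldings [] []
  _∷_ : Folding t w o ls fs → Foldings rs ls′ → Foldings (w ∷ rs) (ls ++ ls′)

foldings-unjoin : ∀ (rs₁ : List (Region n)) {rs₂} xs {α ys β zs} →
  Foldings (rs₁ ++ (ys ++ [ ⟨ α , β ⟩ ]) ∷ (xs ++ ⟨ β , α ⟩ ∷ zs) ∷ rs₂) ls →
  ∃[ ls′ ] Foldings (rs₁ ++ (xs ++ α ∷ ys ++ β ∷ zs) ∷ rs₂) ls′ × ls′ ↭ ⟨ α , β ⟩ ∷ ⟨ β , α ⟩ ∷ ls
foldings-unjoin [] xs (_∷_ {ls = ls₁} F (_∷_ {ls = ls₂} {ls′ = ls₃} F′ Fs))
  with _ , ls , _ , F″ , ls↭ ← folding-unjoin F F′ xs refl =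
  ls ++ ls₃ , F″ ∷ Fs , ↭-trans (++⁺ʳ ls₃ ls↭) (prep _ (prep _ (↭-reflexive (++-assoc ls₁ ls₂ ls₃))))
foldings-unjoin (r ∷ rs₁) xs {α} {β = β} (_∷_ {ls = ls} {ls′ = ls₁} F Fs)
  with ls′ , Fs′ , ls′↭ ← foldings-unjoin rs₁ xs Fs =
  ls ++ ls′ , F ∷ Fs′ , ↭-trans (++⁺ˡ ls ls′↭) (shifts ls (⟨ α , β ⟩ ∷ ⟨ β , α ⟩ ∷ []))

Stuck : State n → Set
Stuck s = ∀ t → ¬ (s ⟶ t)

-- Two free arms in one region would allow a move, so every region is a single letter, folded by
-- `leaf` without new labels.
foldings-stuck : ∀ {ls} → All (_≢ []) rs → Stuck (state {n} ls rs) → Foldings rs []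
foldings-stuck {rs = []}                 []        stuck = []
foldings-stuck {rs = [] ∷ rs}            (ne ∷ _)  stuck = ⊥-elim (ne refl)
foldings-stuck {rs = (α ∷ []) ∷ rs} {ls} (_ ∷ nes) stuck =
  leaf ∷ foldings-stuck {ls = ls} nes
    λ { _ (join rs₁ rs₂ xs α ys β zs) → stuck _ (join (_ ∷ rs₁) rs₂ xs α ys β zs) }
foldings-stuck {rs = (α ∷ β ∷ zs) ∷ rs}  (_ ∷ nes) stuck =
  ⊥-elim (stuck _ (join [] rs [] α [] β zs))

++∷≢[] : ∀ (xs : List A) {x ys} → xs ++ x ∷ ys ≢ []
++∷≢[] []       ()
++∷≢[] (_ ∷ xs) ()

nonempty-⟶ : ∀ {s t : State n} → s ⟶ t → All (_≢ []) (regions s) → All (_≢ []) (regions t)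
nonempty-⟶ (join rs₁ rs₂ xs α ys β zs) nes with All.++⁻ rs₁ nes
... | nes₁ , _ ∷ nes₂ = All.++⁺ nes₁ (++∷≢[] ys ∷ ++∷≢[] xs ∷ nes₂)

-- Starting from the stuck state, the moves are undone one by one. Labels agree only up to order, as
-- arcs may be drawn in an order other than that of the folding.
play⇒foldings : ∀ {s t : State n} → s ⟶* t → Stuck t → All (_≢ []) (regions s) →
                ∃[ ls ] Foldings (regions s) ls × labels t ↭ ls ++ labels s
play⇒foldings ε stuck nes = [] , foldings-stuck nes stuck , ↭-refl
play⇒foldings (m@(join {ls = ls₀} rs₁ rs₂ xs α ys β zs) ◅ ms) stuck nes
  with ls , Fs , t↭ ← play⇒foldings ms stuck (nonempty-⟶ m nes)
  with ls′ , Fs′ , ls′↭ ← foldings-unjoin rs₁ xs Fs =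
  ls′ , Fs′ , ↭-trans t↭ (↭-trans (shifts ls (⟨ α , β ⟩ ∷ ⟨ β , α ⟩ ∷ [])) (++⁺ʳ ls₀ (↭-sym ls′↭)))

-- The bijection between endstates and trees

Singleton : Region n → Set
Singleton r = ∃[ α ] r ≡ [ α ]

folding-singletons : Folding {n} t w o ls fs → All Singleton fs
folding-singletons leaf = []
folding-singletons (node G D P) =
  All.++⁺ (folding-singletons G) (All.++⁺ (folding-singletons D)
    (All.++⁺ (folding-singletons P) ((_ , refl) ∷ [])))

singletons-stuck : ∀ {ls} → All Singleton rs → Stuck (state {n} ls rs)
singletons-stuck sing _ (join rs₁ rs₂ xs α ys β zs) with All.++⁻ʳ rs₁ sing
singletons-stuck sing _ (join rs₁ rs₂ []       α ys β zs) | (_ , eq) ∷ _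
  with () ← ++-conicalʳ ys (β ∷ zs) (∷-injectiveʳ eq)
singletons-stuck sing _ (join rs₁ rs₂ (x ∷ xs) α ys β zs) | (_ , eq) ∷ _
  with () ← ++-conicalʳ xs (α ∷ ys ++ β ∷ zs) (∷-injectiveʳ eq)

module _ {m : ℕ} where
  private
    N : ℕ
    N = suc m

  length-arms : length (arms N) ≡ N
  length-arms = trans (length-map arm (allFin N)) (length-tabulate (λ i → i))

  final : Label N → List (Label N) → List (Region N) → State N
  final o ls fs = state (ls ++ arms N) (fs ++ [ [ o ] ])

  folding-play : Folding t (arms N) o ls fs → initial N ⟶* final o ls fs
  folding-play {o = o} {ls} {fs} F =
    subst (λ w → state (arms N) [ w ] ⟶* final o ls fs) (++-identityʳ (arms N))
      (folding⇒play F [] [] [] [])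

  folding⇒endstate : Folding t (arms N) o ls fs → Endstate N
  folding⇒endstate {o = o} {ls} {fs} F =
    final o ls fs , folding-play F ,
    singletons-stuck (All.++⁺ (folding-singletons F) ((_ , refl) ∷ []))

  -- Playing the folding reaches a consistent state whose free arms are `o` and the letters of `fs`.
  -- Any `S` with the same elements is allowed, so that two foldings can share it.
  folding-compatible : ∀ {S} (S-functional : ∀ {α β γ} → ⟨ β , α ⟩ ∈ S → ⟨ γ , α ⟩ ∈ S → β ≡ γ) →
                       Folding t (arms N) o ls fs → ls ++ arms N ⊆ S → S ⊆ ls ++ arms N →
                       Compatible S S-functional ls fs × Unmatched S S-functional o
  folding-compatible {o = o} {fs = fs} S-functional F sub sup = compatible
      (All.tabulate (sub ∘ ∈-++⁺ˡ))
      (All.tabulate λ r∈fs → All.tabulate λ α∈r m →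
        unmatched c (∈-concat⁺′ α∈r (∈-++⁺ˡ r∈fs)) (sup m)) ,
      λ m → unmatched c (∈-concat⁺′ (here refl) (∈-++⁺ʳ fs (here refl))) (sup m)
    where
    c = consistent-⟶* (folding-play F) (consistent-initial N)

  tree-unique : Folding t (arms N) o ls fs → Folding t′ (arms N) o′ ls′ fs′ →
                ls ++ arms N ∼[ set ] ls′ ++ arms N → t ≡ t′
  tree-unique {ls = ls} F F′ eq =
    let c  , u  = folding-compatible used-once F (λ m → m) (λ m → m)
        c′ , u′ = folding-compatible used-once F′ (Equivalence.from eq) (Equivalence.to eq)
    -- For the whole disk the outputs are free at the end, so `output-unique` supplies their
    -- equality.
    in folding-unique _ used-once F F′ refl (output-unique _ used-once F F′ c c′ u u′)
         (separated-arms N) c c′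
    where
    used-once : ∀ {α β γ} → ⟨ β , α ⟩ ∈ ls ++ arms N → ⟨ γ , α ⟩ ∈ ls ++ arms N → β ≡ γ
    used-once = functional (consistent-⟶* (folding-play F) (consistent-initial N))

  endstate⇒folding : (e : Endstate N) →
    ∃[ t ] ∃[ o ] ∃₂ λ ls fs →
      Folding t (arms N) o ls fs × labels (proj₁ e) ∼[ set ] ls ++ arms N
  endstate⇒folding (s , play , stuck)
    with ls , (F ∷ []) , s↭ ← play⇒foldings play stuck ((λ ()) ∷ []) =
    _ , _ , _ , _ , F ,
    subst (λ ls → labels s ∼[ set ] ls ++ arms N) (++-identityʳ _) (bag-=⇒ (↭⇒∼bag s↭))

  Endstates↔Tree : Inverse (Endstates N) (setoid (Σ[ t ∈ Tree ] size t ≡ m))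
  Endstates↔Tree = record
    { to        = to
    ; from      = from
    ; to-cong   = λ {e} {e′} e≈e′ → tree-≡ (tree-unique (folding e) (folding e′)
                    (S.trans (S.sym (labels≈ e)) (S.trans e≈e′ (labels≈ e′))))
    ; from-cong = λ { refl → S.refl }
    ; inverse   = (λ {x} {e} e≈ → tree-≡ (tree-unique (folding e) (built-folding x)
                    (S.trans (S.sym (labels≈ e)) e≈)))
                -- The endstate rebuilt from the tree of `e` may have been reached by other moves,
                -- but determinism gives it the same labels.
                , λ { {e} refl → S.trans (S.reflexive (cong (_++ arms N)
                    (proj₂ (folding-deterministic (built-folding (to e)) (folding e) refl))))
                    (S.sym (labels≈ e)) }
    }
    where
    module S = Setoid ([ set ]-Equality (Label N))

    tree-≡ : {x y : Σ[ t ∈ Tree ] size t ≡ m} → proj₁ x ≡ proj₁ y → x ≡ y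
    tree-≡ {x = _ , p} {y = _ , q} refl = cong (_ ,_) (≡-irrelevant p q)

    outcome : Endstate N → List (Label N)
    outcome e = proj₁ (proj₂ (proj₂ (endstate⇒folding e)))

    folding : (e : Endstate N) → Folding (proj₁ (endstate⇒folding e)) (arms N) _ (outcome e) _
    folding e = proj₁ (proj₂ (proj₂ (proj₂ (proj₂ (endstate⇒folding e)))))

    labels≈ : (e : Endstate N) → labels (proj₁ e) ∼[ set ] outcome e ++ arms N
    labels≈ e = proj₂ (proj₂ (proj₂ (proj₂ (proj₂ (endstate⇒folding e)))))

    built : (x : Σ[ t ∈ Tree ] size t ≡ m) →
            ∃[ o ] ∃₂ λ ls fs → Folding (proj₁ x) (arms N) o ls fs
    built (t , eq) = folding-exists t (arms N) (trans length-arms (cong suc (sym eq)))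

    built-folding = λ x → proj₂ (proj₂ (proj₂ (built x)))

    to : Endstate N → Σ[ t ∈ Tree ] size t ≡ m
    to e = proj₁ (endstate⇒folding e) ,
           suc-injective (trans (sym (folding-size (folding e))) length-arms)

    from : (Σ[ t ∈ Tree ] size t ≡ m) → Endstate N
    from x = folding⇒endstate (built-folding x)

theorem2 : ∀ (n : ℕ) → 1 ≤ n → ∃[ a ] (HasCardinality (Endstates n) a × (2 * n ∸ 1) * a ≡ (3 * n ∸ 3) C (n ∸ 1))
-- With n = m + 1 the witness counts ternary trees with m nodes, while 2 n - 1 = 1 + 2 m and 3 n - 3
-- = 3 m.
theorem2 (suc m) _ = #forests m 1 , inverse Endstates↔Tree (Tree↔Fin m) , (begin
  (2 * suc m ∸ 1) * #forests m 1  ≡⟨ cong (λ k → (k ∸ 1) * #forests m 1) (*-suc 2 m) ⟩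
  (1 + 2 * m) * #forests m 1      ≡⟨ #forests-one m ⟩
  (3 * m) C m                     ≡⟨ cong (λ k → (k ∸ 3) C m) (*-suc 3 m) ⟨
  (3 * suc m ∸ 3) C m             ∎)
  where open ≡-Reasoning
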